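{- For GT systems $T_1=(\mathcal L,\mathcal R_1)$ and $T_2=(\mathcal L,\mathcal R_2)$ over a common label alphabet: $T_1\cong T_2$ implies $T_1\simeq_N T_2$, which implies $T_1\simeq_S T_2$, which implies $T_1\simeq_F T_2$. Moreover, none of the converse implications holds in general: there exist GT systems that are normalisation equivalent but not isomorphic, step-wise equivalent but not normalisation equivalent, and semantically equivalent but not step-wise equivalent.
   Context: Fix a label alphabet $\mathcal L=(\mathcal L_V,\mathcal L_E)$ of finite sets. A graph over $\mathcal L$ is $G=(V,E,s,t,l,m,p)$ with $V,E$ finite, $s,t:E\to V$ total, $l:V\rightharpoonup\mathcal L_V$ partial, $m:E\to\mathcal L_E$ total, $p:V\rightharpoonup\{0,1\}$ partial (rootedness). $G$ is a TLRG if $l,p$ are total. Morphisms preserve sources, targets, edge labels, and node labels and rootedness wherever defined; isomorphisms are bijective morphisms whose inverse is a morphism. $\mathcal G^{\oplus}(\mathcal L)$ is the set of isomorphism classes $[G]$ of TLRGs. A rule $r=\langle L\leftarrow K\rightarrow R\rangle$ consists of TLRGs $L,R$ and a graph $K$ that is a subgraph of both (sets included, $s,t,m$ restricted, $l_K\subseteq l_L$, $p_K\subseteq p_L$, likewise for $R$). Rule application to TLRG $G$ via an injective $g:L\to G$ satisfying the dangling condition (no edge outside $g(L)$ incident to a node of $g(V_L\setminus V_K)$): delete images of items of $L$ not in $K$, undefine label/rootedness of $g_V(v)$ where undefined for $v\in V_K$; add disjointly items of $R$ not in $K$, set label/rootedness of $g_V(v)$ to $l_R(v)/p_R(v)$ where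 undefined in $K$; $G\Rightarrow_r H$ if $H$ is isomorphic to the result. A GT system $T=(\mathcal L,\mathcal R)$ has a finite rule set $\mathcal R$. Rules $r_1,r_2$ are isomorphic ($r_1\cong r_2$) if there are isomorphisms $f:L_1\to L_2$, $g:R_1\to R_2$ with $f|_{K_1}=g|_{K_1}$ and $f(K_1)=K_2$. The normal form of $r$ is $r{\downarrow}=\langle L\leftarrow K'\rightarrow R\rangle$ with $K'$ having the nodes of $K$, no edges, and undefined labels and rootedness; $r_1\simeq r_2$ iff $r_1{\downarrow}\cong r_2{\downarrow}$. The induced relation $\to_T$ on $\mathcal G^{\oplus}(\mathcal L)$ is $[G]\to_T[H]$ iff $G\Rightarrow_{\mathcal R}H$. The semantic function $f_T:\mathcal G^{\oplus}(\mathcal L)\to\mathcal P(\mathcal G^{\oplus}(\mathcal L)\cup\{\bot\})$ maps $[G]$ to the set of normal forms of $[G]$ w.r.t. $\to_T$ (those $[H]$ with $[G]\to_T^*[H]$ and $[H]$ irreducible), together with $\bot$ iff there is an infinite $\to_T$-sequence starting at $[G]$. Then: $T_1\cong T_2$ iff $\mathcal R_1/{\cong}=\mathcal R_2/{\cong}$ (equal sets of isomorphism classes of rules); $T_1\simeq_N T_2$ iff $\mathcal R_1/{\simeq}=\mathcal R_2/{\simeq}$; $T_1\simeq_S T_2$ iff $\to_{T_1}=\to_{T_2}$; $T_1\simeq_F T_2$ iff $f_{T_1}=f_{T_2}$. -}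

module Defs where

open import Data.Empty using (⊥)
open import Data.Fin using (Fin; zero; suc)
open import Data.Fin.Properties using (any?; inj⇒≟; +↔⊎; 0↔⊥)
open import Data.Irrelevant using ([_])
open import Data.List using (List)
open import Data.List.Relation.Unary.Any using (Any)
open import Data.Maybe using (Maybe; just; nothing; Is-just)
open import Data.Nat using (ℕ; zero; suc; _+_)
open import Data.Product using (∃; ∃-syntax; Σ-syntax; _×_; _,_; proj₁; proj₂)
open import Data.Refinement as Refinement using (Refinement-syntax; value; _,_)
open import Data.Refinement.Properties using (value-injective)
open import Data.Sum using (_⊎_; inj₁; inj₂; [_,_]′)
open import Data.Sum.Function.Propositional using (_⊎-↔_)
open import Function using (_∘_; _↔_; mk↔ₛ′; _⇔_; Inverse; Injective)
open import Function.Construct.Composition using (_↔-∘_)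
open import Function.Construct.Symmetry using (↔-sym)
open import Function.Properties.Inverse using (↔⇒↣)
open import Level using () renaming (zero to lzero; suc to lsuc)
open import Relation.Binary.Construct.Closure.ReflexiveTransitive using (Star)
open import Relation.Binary.Definitions using (DecidableEquality)
open import Relation.Binary.PropositionalEquality using (_≡_; refl; sym; trans; cong; subst)
open import Relation.Binary.Rewriting using (IsNormalForm)
open import Relation.Nullary using (¬_; Dec; yes; no; ¬?; contradiction; contradiction-irr)
open import Relation.Nullary.Decidable using (map′; _×-dec_)
open import Relation.Unary using (Pred; Decidable; _≐_)

------------------------------------------------------------------------
-- Finite sets

Finite : Set → Set
Finite A = ∃[ n ] (A ↔ Fin n)

module _ {A : Set} (fin : Finite A) where

  private
    open module E = Inverse (proj₂ fin) using (to; from)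

  finite-≟ : DecidableEquality A
  finite-≟ = inj⇒≟ (↔⇒↣ (proj₂ fin))

  finite-any? : {P : A → Set} → Decidable P → Dec (∃ P)
  finite-any? {P} P? = map′
    (λ (i , p) → from i , p)
    (λ (a , p) → to a , subst P (sym (E.strictlyInverseʳ a)) p)
    (any? (P? ∘ from))

finite-⊥ : Finite ⊥
finite-⊥ = 0 , ↔-sym 0↔⊥

finite-⊎ : {A B : Set} → Finite A → Finite B → Finite (A ⊎ B)
finite-⊎ (m , f) (n , g) = m + n , ↔-sym +↔⊎ ↔-∘ (f ⊎-↔ g)

private
  Fin-refinement : ∀ n {P : Fin n → Set} → Decidable P →
                   Finite [ i ∈ Fin n ∣ P i ]
  Fin-refinement zero P? =
    0 , mk↔ₛ′ (λ ()) (λ ()) (λ ()) (λ ())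
  Fin-refinement (suc n) {P} P? with P? zero | Fin-refinement n (P? ∘ suc)
  ... | yes p | m , φ = suc m , mk↔ₛ′ to′ from′ to∘from from∘to
    where
    open Inverse φ
    to′ : [ i ∈ Fin (suc n) ∣ P i ] → Fin (suc m)
    to′ (zero  , _) = zero
    to′ (suc i , q) = suc (to (i , q))
    from′ : Fin (suc m) → [ i ∈ Fin (suc n) ∣ P i ]
    from′ zero    = zero , [ p ]
    from′ (suc j) = Refinement.map suc (λ q → q) (from j)
    to∘from : ∀ j → to′ (from′ j) ≡ j
    to∘from zero    = refl
    to∘from (suc j) = cong suc (strictlyInverseˡ j)
    from∘to : ∀ i → from′ (to′ i) ≡ i
    from∘to (zero  , _) = refl
    from∘to (suc i , q) =
      value-injective (cong (suc ∘ value) (strictlyInverseʳ (i , q)))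
  ... | no ¬p | m , φ = m , mk↔ₛ′ to′ from′ strictlyInverseˡ from∘to
    where
    open Inverse φ
    to′ : [ i ∈ Fin (suc n) ∣ P i ] → Fin m
    to′ (zero  , [ q ]) = contradiction-irr q ¬p
    to′ (suc i , q)     = to (i , q)
    from′ : Fin m → [ i ∈ Fin (suc n) ∣ P i ]
    from′ j = Refinement.map suc (λ q → q) (from j)
    from∘to : ∀ i → from′ (to′ i) ≡ i
    from∘to (zero  , [ q ]) = contradiction-irr q ¬p
    from∘to (suc i , q)     =
      value-injective (cong (suc ∘ value) (strictlyInverseʳ (i , q)))

finite-refinement : {A : Set} {P : A → Set} → Finite A → Decidable P →
                    Finite [ a ∈ A ∣ P a ]
finite-refinement {A} {P} (n , φ) P? = proj₁ sub , proj₂ sub ↔-∘ φ′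
  where
  open Inverse φ
  sub : Finite [ i ∈ Fin n ∣ P (from i) ]
  sub = Fin-refinement n (P? ∘ from)
  φ′ : [ a ∈ A ∣ P a ] ↔ [ i ∈ Fin n ∣ P (from i) ]
  φ′ = mk↔ₛ′
    (Refinement.map to (λ {a} → subst P (sym (strictlyInverseʳ a))))
    (Refinement.map from (λ p → p))
    (λ (i , _) → value-injective (strictlyInverseˡ i))
    (λ (a , _) → value-injective (strictlyInverseʳ a))

_∈Im_ : {A B : Set} → B → (A → B) → Set
b ∈Im f = ∃[ a ] f a ≡ b

------------------------------------------------------------------------
-- Graphs

record Alphabet : Set₁ where
  field
    LV LE  : Set
    LV-fin : Finite LV
    LE-fin : Finite LE

-- Partial functions are Maybe-valued; of the two values of p, 1 means
-- rooted and 0 unrooted.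
record Graph (ℒ : Alphabet) : Set₁ where
  open Alphabet ℒ
  field
    V E   : Set
    V-fin : Finite V
    E-fin : Finite E
    s t   : E → V
    l     : V → Maybe LV
    m     : E → LE
    p     : V → Maybe (Fin 2)

record TLRG (ℒ : Alphabet) : Set₁ where
  field
    graph : Graph ℒ
  open Graph graph public
  field
    l-total : ∀ v → Is-just (l v)
    p-total : ∀ v → Is-just (p v)

open TLRG using (graph)

module _ {ℒ : Alphabet} where

  record Morphism (G H : Graph ℒ) : Set where
    private
      module G = Graph G
      module H = Graph H
    field
      onV    : G.V → H.V
      onE    : G.E → H.E
      pres-s : ∀ e → H.s (onE e) ≡ onV (G.s e)
      pres-t : ∀ e → H.t (onE e) ≡ onV (G.t e)
      pres-m : ∀ e → H.m (onE e) ≡ G.m e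
      pres-l : ∀ v {x} → G.l v ≡ just x → H.l (onV v) ≡ just x
      pres-p : ∀ v {x} → G.p v ≡ just x → H.p (onV v) ≡ just x

  record InjectiveMorphism (G H : Graph ℒ) : Set where
    field
      morphism : Morphism G H
    open Morphism morphism public
    field
      onV-injective : Injective _≡_ _≡_ onV
      onE-injective : Injective _≡_ _≡_ onE

  infix 4 _≅_
  record _≅_ (G H : Graph ℒ) : Set where
    field
      to   : Morphism G H
      from : Morphism H G
    open Morphism
    field
      toV∘fromV : ∀ v → onV to (onV from v) ≡ v
      fromV∘toV : ∀ v → onV from (onV to v) ≡ v
      toE∘fromE : ∀ e → onE to (onE from e) ≡ e
      fromE∘toE : ∀ e → onE from (onE to e) ≡ e

------------------------------------------------------------------------
-- Rules

-- K is regarded as a subgraph of L and of R through injective morphisms,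
-- which play the role of the set inclusions: a morphism restricts s, t
-- and m, and extends l and p.
record Rule (ℒ : Alphabet) : Set₁ where
  field
    L   : TLRG ℒ
    K   : Graph ℒ
    R   : TLRG ℒ
    K⊆L : InjectiveMorphism K (graph L)
    K⊆R : InjectiveMorphism K (graph R)

module _ {ℒ : Alphabet} where

  -- The isomorphism onK expresses both that f and g agree on K₁ and that
  -- their common restriction maps K₁ onto K₂, as graphs.
  infix 4 _≅ᴿ_
  record _≅ᴿ_ (r₁ r₂ : Rule ℒ) : Set where
    private
      module r₁ = Rule r₁
      module r₂ = Rule r₂
    open InjectiveMorphism using (onV; onE)
    field
      f   : graph r₁.L ≅ graph r₂.L
      g   : graph r₁.R ≅ graph r₂.R
      onK : r₁.K ≅ r₂.K
    private
      module f   = Morphism (_≅_.to f)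
      module g   = Morphism (_≅_.to g)
      module onK = Morphism (_≅_.to onK)
    field
      f-onV : ∀ v → f.onV (onV r₁.K⊆L v) ≡ onV r₂.K⊆L (onK.onV v)
      f-onE : ∀ e → f.onE (onE r₁.K⊆L e) ≡ onE r₂.K⊆L (onK.onE e)
      g-onV : ∀ v → g.onV (onV r₁.K⊆R v) ≡ onV r₂.K⊆R (onK.onV v)
      g-onE : ∀ e → g.onE (onE r₁.K⊆R e) ≡ onE r₂.K⊆R (onK.onE e)

  discrete : Graph ℒ → Graph ℒ
  discrete K = record
    { V = V ; E = ⊥ ; V-fin = V-fin ; E-fin = finite-⊥
    ; s = λ () ; t = λ () ; l = λ _ → nothing ; m = λ () ; p = λ _ → nothing }
    where open Graph K

  discrete-⊆ : {K G : Graph ℒ} → InjectiveMorphism K G →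
               InjectiveMorphism (discrete K) G
  discrete-⊆ i = record
    { morphism = record
      { onV = onV ; onE = λ ()
      ; pres-s = λ () ; pres-t = λ () ; pres-m = λ ()
      ; pres-l = λ _ () ; pres-p = λ _ () }
    ; onV-injective = onV-injective
    ; onE-injective = λ { {()} } }
    where open InjectiveMorphism i

  infix 8 _↓
  _↓ : Rule ℒ → Rule ℒ
  r ↓ = record
    { L = L ; K = discrete K ; R = R
    ; K⊆L = discrete-⊆ K⊆L ; K⊆R = discrete-⊆ K⊆R }
    where open Rule r

  infix 4 _≃ᴿ_
  _≃ᴿ_ : Rule ℒ → Rule ℒ → Set
  r₁ ≃ᴿ r₂ = r₁ ↓ ≅ᴿ r₂ ↓

------------------------------------------------------------------------
-- Rule application

module Match {ℒ : Alphabet} (r : Rule ℒ) (G : TLRG ℒ)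
             (match : InjectiveMorphism (graph (Rule.L r)) (graph G)) where

  open Rule r
  private
    module L = TLRG L
    module K = Graph K
    module R = TLRG R
    module G = TLRG G
    module i = InjectiveMorphism K⊆L
    module j = InjectiveMorphism K⊆R
    module g = InjectiveMorphism match

  DeletedV : G.V → Set
  DeletedV v = ∃[ u ] g.onV u ≡ v × ¬ (u ∈Im i.onV)

  DeletedE : G.E → Set
  DeletedE e = ∃[ d ] g.onE d ≡ e × ¬ (d ∈Im i.onE)

  Dangling : Set
  Dangling = ∀ e → ¬ (e ∈Im g.onE) → ¬ DeletedV (G.s e) × ¬ DeletedV (G.t e)

  private
    inKV? : Decidable (_∈Im i.onV)
    inKV? u = finite-any? K.V-fin λ k → finite-≟ L.V-fin (i.onV k) u

    inKE? : Decidable (_∈Im i.onE)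
    inKE? d = finite-any? K.E-fin λ k → finite-≟ L.E-fin (i.onE k) d

    onV? : Decidable (_∈Im j.onV)
    onV? u = finite-any? K.V-fin λ k → finite-≟ R.V-fin (j.onV k) u

    onE? : Decidable (_∈Im j.onE)
    onE? d = finite-any? K.E-fin λ k → finite-≟ R.E-fin (j.onE k) d

    matchedE? : Decidable (_∈Im g.onE)
    matchedE? e = finite-any? L.E-fin λ d → finite-≟ G.E-fin (g.onE d) e

  deletedV? : Decidable DeletedV
  deletedV? v = finite-any? L.V-fin λ u →
    finite-≟ G.V-fin (g.onV u) v ×-dec ¬? (inKV? u)

  deletedE? : Decidable DeletedE
  deletedE? e = finite-any? L.E-fin λ d →
    finite-≟ G.E-fin (g.onE d) e ×-dec ¬? (inKE? d)

  K-survives : ∀ k → ¬ DeletedV (g.onV (i.onV k))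
  K-survives k (u , gu≡gk , u∉K) = u∉K (k , sym (g.onV-injective gu≡gk))

  private
    survives : Dangling →
      (end : G.E → G.V) (endL : L.E → L.V) (endK : K.E → K.V) →
      (∀ e → ¬ (e ∈Im g.onE) → ¬ DeletedV (end e)) →
      (∀ d → end (g.onE d) ≡ g.onV (endL d)) →
      (∀ k → endL (i.onE k) ≡ i.onV (endK k)) →
      ∀ {e} → ¬ DeletedE e → ¬ DeletedV (end e)
    survives dang end endL endK out pg pi {e} ¬del with matchedE? e
    ... | no ∉g = out e ∉g
    ... | yes (d , refl) with inKE? d
    ...   | no ∉K = contradiction (d , refl , ∉K) ¬del
    ...   | yes (k , refl) =
      subst (¬_ ∘ DeletedV) (sym (trans (pg d) (cong g.onV (pi k))))
            (K-survives (endK k))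

  s-survives : Dangling → ∀ {e} → ¬ DeletedE e → ¬ DeletedV (G.s e)
  s-survives dang = survives dang G.s L.s K.s
    (λ e ∉g → proj₁ (dang e ∉g)) g.pres-s i.pres-s

  t-survives : Dangling → ∀ {e} → ¬ DeletedE e → ¬ DeletedV (G.t e)
  t-survives dang = survives dang G.t L.t K.t
    (λ e ∉g → proj₂ (dang e ∉g)) g.pres-t i.pres-t

  -- Labels and rootedness are treated alike, with x in the role of l or p.
  module Relabelling {X : Set} (xK : K.V → Maybe X) where

    Undefined : G.V → Set
    Undefined v = ∃[ k ] g.onV (i.onV k) ≡ v × xK k ≡ nothing

    private
      nothing? : (x : Maybe X) → Dec (x ≡ nothing)
      nothing? nothing  = yes refl
      nothing? (just _) = no λ ()

    undefined? : Decidable Undefined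
    undefined? v = finite-any? K.V-fin λ k →
      finite-≟ G.V-fin (g.onV (i.onV k)) v ×-dec nothing? (xK k)

    undefine : (G.V → Maybe X) → G.V → Maybe X
    undefine xG v with undefined? v
    ... | yes _ = nothing
    ... | no  _ = xG v

    -- The node k is unique, since g and K⊆L are injective.
    redefine : (R.V → Maybe X) → (G.V → Maybe X) → G.V → Maybe X
    redefine xR xD v with undefined? v
    ... | yes (k , _) = xR (j.onV k)
    ... | no  _       = xD v

    redefine-total : {xR : R.V → Maybe X} {xG : G.V → Maybe X} →
      (∀ v → Is-just (xR v)) → (∀ v → Is-just (xG v)) →
      ∀ v → Is-just (redefine xR (undefine xG) v)
    redefine-total totR totG v with undefined? v in eq
    ... | yes (k , _) = totR (j.onV k)
    ... | no  _ rewrite eq = totG v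

  private
    module Lab  = Relabelling K.l
    module Root = Relabelling K.p

  module _ (dang : Dangling) where

    intermediate : Graph ℒ
    intermediate = record
      { V     = [ v ∈ G.V ∣ ¬ DeletedV v ]
      ; E     = [ e ∈ G.E ∣ ¬ DeletedE e ]
      ; V-fin = finite-refinement G.V-fin (¬? ∘ deletedV?)
      ; E-fin = finite-refinement G.E-fin (¬? ∘ deletedE?)
      ; s     = Refinement.map G.s (s-survives dang)
      ; t     = Refinement.map G.t (t-survives dang)
      ; l     = Lab.undefine G.l ∘ value
      ; m     = G.m ∘ value
      ; p     = Root.undefine G.p ∘ value
      }

    private
      module D = Graph intermediate

    NewV NewE : Set
    NewV = [ u ∈ R.V ∣ ¬ (u ∈Im j.onV) ]
    NewE = [ d ∈ R.E ∣ ¬ (d ∈Im j.onE) ]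

    embed : R.V → D.V ⊎ NewV
    embed u with onV? u
    ... | yes (k , _) = inj₁ (g.onV (i.onV k) , [ K-survives k ])
    ... | no  u∉K     = inj₂ (u , [ u∉K ])

    result : TLRG ℒ
    result = record
      { graph = record
        { V     = D.V ⊎ NewV
        ; E     = D.E ⊎ NewE
        ; V-fin = finite-⊎ D.V-fin (finite-refinement R.V-fin (¬? ∘ onV?))
        ; E-fin = finite-⊎ D.E-fin (finite-refinement R.E-fin (¬? ∘ onE?))
        ; s     = [ inj₁ ∘ D.s , embed ∘ R.s ∘ value ]′
        ; t     = [ inj₁ ∘ D.t , embed ∘ R.t ∘ value ]′
        ; l     = [ Lab.redefine R.l (Lab.undefine G.l) ∘ value , R.l ∘ value ]′
        ; m     = [ D.m , R.m ∘ value ]′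
        ; p     = [ Root.redefine R.p (Root.undefine G.p) ∘ value , R.p ∘ value ]′
        }
      ; l-total = λ where
          (inj₁ v) → Lab.redefine-total R.l-total G.l-total (value v)
          (inj₂ u) → R.l-total (value u)
      ; p-total = λ where
          (inj₁ v) → Root.redefine-total R.p-total G.p-total (value v)
          (inj₂ u) → R.p-total (value u)
      }

module _ {ℒ : Alphabet} where

  infix 4 _⇒⟨_⟩_
  _⇒⟨_⟩_ : TLRG ℒ → Rule ℒ → TLRG ℒ → Set
  G ⇒⟨ r ⟩ H =
    Σ[ match ∈ InjectiveMorphism (graph (Rule.L r)) (graph G) ]
    Σ[ dang ∈ Match.Dangling r G match ]
      graph H ≅ graph (Match.result r G match dang)

------------------------------------------------------------------------
-- Graph transformation systems

record GTSystem (ℒ : Alphabet) : Set₁ where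
  field
    rules : List (Rule ℒ)

open GTSystem

-- Elements of the set of isomorphism classes of TLRGs are given by
-- representatives; all notions below are invariant under isomorphism.
module _ {ℒ : Alphabet} where

  infix 4 _⊢_⟶_ _⊢_⟶*_
  _⊢_⟶_ : GTSystem ℒ → TLRG ℒ → TLRG ℒ → Set₁
  T ⊢ G ⟶ H = Any (λ r → G ⇒⟨ r ⟩ H) (rules T)

  -- Zero steps must relate any two representatives of the same class,
  -- hence the final isomorphism.
  _⊢_⟶*_ : GTSystem ℒ → TLRG ℒ → TLRG ℒ → Set₁
  T ⊢ G ⟶* H = ∃[ H′ ] Star (T ⊢_⟶_) G H′ × graph H′ ≅ graph H

  Diverges : GTSystem ℒ → TLRG ℒ → Set₁
  Diverges T G =
    Σ[ γ ∈ (ℕ → TLRG ℒ) ] graph G ≅ graph (γ 0) × (∀ n → T ⊢ γ n ⟶ γ (suc n))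

  -- The element nothing stands for ⊥.
  semantics : GTSystem ℒ → TLRG ℒ → Pred (Maybe (TLRG ℒ)) (lsuc lzero)
  semantics T G (just H) = T ⊢ G ⟶* H × IsNormalForm (T ⊢_⟶_) H
  semantics T G nothing  = Diverges T G

  -- R₁/∼ = R₂/∼: a class [ r ] belongs to Rₖ/∼ when some rule in Rₖ is ∼ r.
  SameClasses : (Rule ℒ → Rule ℒ → Set) → List (Rule ℒ) → List (Rule ℒ) → Set₁
  SameClasses _∼_ R₁ R₂ = ∀ r → Any (r ∼_) R₁ ⇔ Any (r ∼_) R₂

  infix 4 _≅ᵀ_ _≃N_ _≃S_ _≃F_
  _≅ᵀ_ _≃N_ _≃S_ _≃F_ : GTSystem ℒ → GTSystem ℒ → Set₁
  T₁ ≅ᵀ T₂ = SameClasses _≅ᴿ_ (rules T₁) (rules T₂)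
  T₁ ≃N T₂ = SameClasses _≃ᴿ_ (rules T₁) (rules T₂)
  T₁ ≃S T₂ = ∀ G H → (T₁ ⊢ G ⟶ H) ⇔ (T₂ ⊢ G ⟶ H)
  T₁ ≃F T₂ = ∀ G → semantics T₁ G ≐ semantics T₂ G

{-# OPTIONS --safe #-}

-- Applying r = ⟨L ← K → R⟩ to G along g yields a graph whose nodes and edges
-- are the items of G outside g(L) together with the items of R, and this
-- gluing depends on K only through its nodes. The result is therefore
-- determined by the normal form of r, which gives the implication from ≃N to
-- ≃S.
--
-- For the converses, let id P be the rule P ← P → P. The systems {id •} and
-- {id •↓} separate ≅ from ≃N. Every G ⇒ H by some id P has H ≅ G, and id ∅
-- applies to every graph; hence {id ∅} and {id ∅ , id •} separate ≃N from ≃S.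
-- Every system with id ∅ diverges everywhere and has no normal forms; hence
-- {id ∅} and {id ∅ , ∅ ← ∅ → •} separate ≃S from ≃F.
module Submission where

open import Defs
open import Data.Empty using (⊥; ⊥-elim-irr)
open import Data.Fin using (Fin; zero)
open import Data.Irrelevant using ([_])
open import Data.List using (List; []; _∷_)
open import Data.List.Membership.Propositional using (find)
open import Data.List.Relation.Unary.Any as Any using (Any; here; there)
open import Data.Maybe using (Maybe; just; nothing; Is-just)
import Data.Maybe.Relation.Unary.Any as Maybe
open import Data.Nat using (suc)
open import Data.Product using (∃; Σ-syntax; _×_; _,_; proj₁; proj₂)
open import Data.Refinement as Refinement using (Refinement-syntax; value; _,_)
open import Data.Refinement.Properties using (value-injective)
open import Data.Sum using (_⊎_; inj₁; inj₂; [_,_]′)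
open import Data.Sum.Function.Propositional using (_⊎-↔_)
open import Data.Unit using (tt)
open import Function
  using (_∘_; id; mk⇔; _↔_; mk↔ₛ′; Inverse; Equivalence; Injection; Injective)
open import Function.Construct.Composition using (_↔-∘_)
open import Function.Construct.Identity using (↔-id)
open import Function.Construct.Symmetry using (⇔-sym)
open import Function.Properties.Inverse using (↔⇒↣)
open import Relation.Binary.Construct.Closure.ReflexiveTransitive as Star using ()
open import Relation.Binary.PropositionalEquality
  using (_≡_; refl; sym; trans; cong; module ≡-Reasoning)
open import Relation.Nullary using (¬_; yes; no; contradiction)
open import Relation.Unary using (Decidable)

open TLRG using (graph)

-- Comparing two sets through bijections from a common third.

through : {A B C : Set} → A ↔ B → A ↔ C → B → C
through a b = Inverse.to b ∘ Inverse.from a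

through-inverse : {A B C : Set} (a : A ↔ B) (b : A ↔ C) → ∀ v →
                  through b a (through a b v) ≡ v
through-inverse a b v =
  trans (cong a.to (b.strictlyInverseʳ (a.from v))) (a.strictlyInverseˡ v)
  where
  module a = Inverse a
  module b = Inverse b

through-respects : {A B C D : Set} {x : B → D} {y : C → D} {z : A → D}
  (a : A ↔ B) (b : A ↔ C) →
  (∀ v → x (Inverse.to a v) ≡ z v) → (∀ v → y (Inverse.to b v) ≡ z v) →
  ∀ v → y (through a b v) ≡ x v
through-respects {x = x} {y} {z} a b xz yz v = begin
  y (b.to (a.from v)) ≡⟨ yz (a.from v) ⟩
  z (a.from v)        ≡⟨ xz (a.from v) ⟨
  x (a.to (a.from v)) ≡⟨ cong x (a.strictlyInverseˡ v) ⟩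
  x v                 ∎
  where
  open ≡-Reasoning
  module a = Inverse a
  module b = Inverse b

-- Replacing the image of one set by another.

Unmatched : {A B : Set} → (A → B) → Set
Unmatched {B = B} f = [ b ∈ B ∣ ¬ (b ∈Im f) ]

-- Rule application treats nodes and edges alike at the level of sets, so `K`, `L`, `R`, `G` stand
-- for either kind of item. `Replaced` has the form of the item sets of `Match.result`.
module Replacement {K L R G : Set} {i : K → L} {j : K → R} {m : L → G}
  (i-injective : Injective _≡_ _≡_ i) (j-injective : Injective _≡_ _≡_ j)
  (m-injective : Injective _≡_ _≡_ m)
  (i? : Decidable (_∈Im i)) (j? : Decidable (_∈Im j)) (m? : Decidable (_∈Im m))
  where

  Deleted : G → Set
  Deleted v = ∃ λ u → m u ≡ v × ¬ (u ∈Im i)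

  Replaced : Set
  Replaced = [ v ∈ G ∣ ¬ Deleted v ] ⊎ Unmatched j

  preserved : ∀ k → ¬ Deleted (m (i k))
  preserved k (u , mu≡mik , u∉i) = u∉i (k , sym (m-injective mu≡mik))

  place : R → Replaced
  place u with j? u
  ... | yes (k , _) = inj₁ (m (i k) , [ preserved k ])
  ... | no  u∉j     = inj₂ (u , [ u∉j ])

  place-preserved : ∀ k → place (j k) ≡ inj₁ (m (i k) , [ preserved k ])
  place-preserved k with j? (j k)
  ... | yes (_ , eq) rewrite j-injective eq = refl
  ... | no  jk∉j     = contradiction (k , refl) jk∉j

  place-new : (u : Unmatched j) → place (value u) ≡ inj₂ u
  place-new (u , [ u∉j ]) with j? u
  ... | yes u∈j = ⊥-elim-irr (u∉j u∈j)
  ... | no  _   = refl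

  private
    to : Unmatched m ⊎ R → Replaced
    to (inj₁ v) = inj₁ (Refinement.map id (λ v∉m (u , mu≡v , _) → v∉m (u , mu≡v)) v)
    to (inj₂ u) = place u

    from : Replaced → Unmatched m ⊎ R
    from (inj₂ u) = inj₂ (value u)
    from (inj₁ (v , [ ¬del ])) with m? v
    ... | no  v∉m       = inj₁ (v , [ v∉m ])
    ... | yes (u , mu≡v) with i? u
    -- A matched item that survives comes from `K` and is counted as an item of `R`.
    ...   | yes (k , _) = inj₂ (j k)
    ...   | no  u∉i     = ⊥-elim-irr (¬del (u , mu≡v , u∉i))

    from-preserved : ∀ k → from (inj₁ (m (i k) , [ preserved k ])) ≡ inj₂ (j k)
    from-preserved k with m? (m (i k))
    ... | no  ∉m = contradiction (i k , refl) ∉m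
    ... | yes (u , mu≡mik) with i? u
    -- The search may return another preimage; injectivity of `m` and `i` identifies it with `k`.
    ...   | yes (_ , ik′≡u) = cong (inj₂ ∘ j) (i-injective (trans ik′≡u (m-injective mu≡mik)))
    ...   | no  u∉i         = contradiction (k , sym (m-injective mu≡mik)) u∉i

    to∘from : ∀ x → to (from x) ≡ x
    to∘from (inj₂ u) = place-new u
    to∘from (inj₁ (v , [ ¬del ])) with m? v
    ... | no  _          = refl
    ... | yes (u , refl) with i? u
    ...   | yes (k , refl) = place-preserved k
    ...   | no  u∉i        = ⊥-elim-irr (¬del (u , refl , u∉i))

    from∘to : ∀ x → from (to x) ≡ x
    from∘to (inj₁ (v , [ v∉m ])) with m? v
    ... | no  _   = refl
    ... | yes v∈m = ⊥-elim-irr (v∉m v∈m)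
    from∘to (inj₂ u) with j? u
    ... | no  _          = refl
    ... | yes (k , refl) = from-preserved k

  -- The survivors in `G` are the items outside the match and the images of `K`; the latter,
  -- together with the new items, make up `R`.
  replaced : (Unmatched m ⊎ R) ↔ Replaced
  replaced = mk↔ₛ′ to from to∘from from∘to

-- Isomorphisms of graphs and of rules.

module _ {ℒ : Alphabet} where

  open _≅_
  open Morphism

  ≅-refl : {G : Graph ℒ} → G ≅ G
  ≅-refl = record
    { to = idᴹ ; from = idᴹ
    ; toV∘fromV = λ _ → refl ; fromV∘toV = λ _ → refl
    ; toE∘fromE = λ _ → refl ; fromE∘toE = λ _ → refl }
    where
    idᴹ = record
      { onV = id ; onE = id
      ; pres-s = λ _ → refl ; pres-t = λ _ → refl ; pres-m = λ _ → refl
      ; pres-l = λ _ → id ; pres-p = λ _ → id }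

  ≅-sym : {G H : Graph ℒ} → G ≅ H → H ≅ G
  ≅-sym φ = record
    { to = from φ ; from = to φ
    ; toV∘fromV = fromV∘toV φ ; fromV∘toV = toV∘fromV φ
    ; toE∘fromE = fromE∘toE φ ; fromE∘toE = toE∘fromE φ }

  private
    -- Morphisms preserve attributes only where these are defined; totality of the source turns
    -- preservation into an equation.
    total-pres : {V W A : Set} {x : V → Maybe A} (y : W → Maybe A) (h : V → W) →
      (∀ v → Is-just (x v)) → (∀ v {a} → x v ≡ just a → y (h v) ≡ just a) →
      ∀ v → y (h v) ≡ x v
    total-pres {x = x} y h total pres v with x v in eq | total v
    ... | just _ | _ = pres v eq

  preserves-l : (G : TLRG ℒ) {H : Graph ℒ} (φ : Morphism (graph G) H) →
                ∀ v → Graph.l H (onV φ v) ≡ TLRG.l G v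
  preserves-l G {H} φ = total-pres (Graph.l H) (onV φ) (TLRG.l-total G) (pres-l φ)

  preserves-p : (G : TLRG ℒ) {H : Graph ℒ} (φ : Morphism (graph G) H) →
                ∀ v → Graph.p H (onV φ v) ≡ TLRG.p G v
  preserves-p G {H} φ = total-pres (Graph.p H) (onV φ) (TLRG.p-total G) (pres-p φ)

  infixr 9 _∘ᴹ_
  _∘ᴹ_ : {G H I : Graph ℒ} → Morphism H I → Morphism G H → Morphism G I
  ψ ∘ᴹ φ = record
    { onV = onV ψ ∘ onV φ ; onE = onE ψ ∘ onE φ
    ; pres-s = λ e → trans (pres-s ψ (onE φ e)) (cong (onV ψ) (pres-s φ e))
    ; pres-t = λ e → trans (pres-t ψ (onE φ e)) (cong (onV ψ) (pres-t φ e))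
    ; pres-m = λ e → trans (pres-m ψ (onE φ e)) (pres-m φ e)
    ; pres-l = λ v eq → pres-l ψ (onV φ v) (pres-l φ v eq)
    ; pres-p = λ v eq → pres-p ψ (onV φ v) (pres-p φ v eq) }

  ≅-trans : {G H I : Graph ℒ} → G ≅ H → H ≅ I → G ≅ I
  ≅-trans φ ψ = record
    { to = to ψ ∘ᴹ to φ ; from = from φ ∘ᴹ from ψ
    ; toV∘fromV = λ v → trans (cong (onV (to ψ)) (toV∘fromV φ _)) (toV∘fromV ψ v)
    ; fromV∘toV = λ v → trans (cong (onV (from φ)) (fromV∘toV ψ _)) (fromV∘toV φ v)
    ; toE∘fromE = λ e → trans (cong (onE (to ψ)) (toE∘fromE φ _)) (toE∘fromE ψ e)
    ; fromE∘toE = λ e → trans (cong (onE (from φ)) (fromE∘toE ψ _)) (fromE∘toE φ e) }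

  V↔ : {G H : Graph ℒ} → G ≅ H → Graph.V G ↔ Graph.V H
  V↔ φ = mk↔ₛ′ (onV (to φ)) (onV (from φ)) (toV∘fromV φ) (fromV∘toV φ)

  E↔ : {G H : Graph ℒ} → G ≅ H → Graph.E G ↔ Graph.E H
  E↔ φ = mk↔ₛ′ (onE (to φ)) (onE (from φ)) (toE∘fromE φ) (fromE∘toE φ)

  ≅⇒injective : {G H : Graph ℒ} → G ≅ H → InjectiveMorphism G H
  ≅⇒injective φ = record
    { morphism = to φ
    ; onV-injective = Injection.injective (↔⇒↣ (V↔ φ))
    ; onE-injective = Injection.injective (↔⇒↣ (E↔ φ)) }

  infixr 9 _∘ᴵ_
  _∘ᴵ_ : {G H I : Graph ℒ} →
         InjectiveMorphism H I → InjectiveMorphism G H → InjectiveMorphism G I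
  ψ ∘ᴵ φ = record
    { morphism = ψ.morphism ∘ᴹ φ.morphism
    ; onV-injective = φ.onV-injective ∘ ψ.onV-injective
    ; onE-injective = φ.onE-injective ∘ ψ.onE-injective }
    where
    module ψ = InjectiveMorphism ψ
    module φ = InjectiveMorphism φ

  discrete-≅ : (K₁ K₂ : Graph ℒ) → Graph.V K₁ ↔ Graph.V K₂ → discrete K₁ ≅ discrete K₂
  discrete-≅ _ _ V↔V = record
    { to   = record
      { onV = V.to ; onE = λ () ; pres-s = λ () ; pres-t = λ () ; pres-m = λ ()
      ; pres-l = λ _ () ; pres-p = λ _ () }
    ; from = record
      { onV = V.from ; onE = λ () ; pres-s = λ () ; pres-t = λ () ; pres-m = λ ()
      ; pres-l = λ _ () ; pres-p = λ _ () }
    ; toV∘fromV = V.strictlyInverseˡ ; fromV∘toV = V.strictlyInverseʳ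
    ; toE∘fromE = λ () ; fromE∘toE = λ () }
    where module V = Inverse V↔V

  ≅ᴿ-refl : {r : Rule ℒ} → r ≅ᴿ r
  ≅ᴿ-refl = record
    { f = ≅-refl ; g = ≅-refl ; onK = ≅-refl
    ; f-onV = λ _ → refl ; f-onE = λ _ → refl
    ; g-onV = λ _ → refl ; g-onE = λ _ → refl }

  private
    square-sym : {A B C D : Set} {h : A → C} {k : B → D}
      (a : A ↔ B) (c : C ↔ D) →
      (∀ x → Inverse.to c (h x) ≡ k (Inverse.to a x)) →
      ∀ y → Inverse.from c (k y) ≡ h (Inverse.from a y)
    square-sym {h = h} {k} a c comm y = begin
      c.from (k y)                 ≡⟨ cong (c.from ∘ k) (a.strictlyInverseˡ y) ⟨
      c.from (k (a.to (a.from y))) ≡⟨ cong c.from (comm (a.from y)) ⟨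
      c.from (c.to (h (a.from y))) ≡⟨ c.strictlyInverseʳ _ ⟩
      h (a.from y)                 ∎
      where
      open ≡-Reasoning
      module a = Inverse a
      module c = Inverse c

  ≅ᴿ-sym : {r₁ r₂ : Rule ℒ} → r₁ ≅ᴿ r₂ → r₂ ≅ᴿ r₁
  ≅ᴿ-sym φ = record
    { f = ≅-sym f ; g = ≅-sym g ; onK = ≅-sym onK
    ; f-onV = square-sym (V↔ onK) (V↔ f) f-onV
    ; f-onE = square-sym (E↔ onK) (E↔ f) f-onE
    ; g-onV = square-sym (V↔ onK) (V↔ g) g-onV
    ; g-onE = square-sym (E↔ onK) (E↔ g) g-onE }
    where open _≅ᴿ_ φ

  ≅ᴿ-trans : {r₁ r₂ r₃ : Rule ℒ} → r₁ ≅ᴿ r₂ → r₂ ≅ᴿ r₃ → r₁ ≅ᴿ r₃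
  ≅ᴿ-trans φ ψ = record
    { f = ≅-trans φ.f ψ.f ; g = ≅-trans φ.g ψ.g ; onK = ≅-trans φ.onK ψ.onK
    ; f-onV = λ v → trans (cong (onV (to ψ.f)) (φ.f-onV v)) (ψ.f-onV _)
    ; f-onE = λ e → trans (cong (onE (to ψ.f)) (φ.f-onE e)) (ψ.f-onE _)
    ; g-onV = λ v → trans (cong (onV (to ψ.g)) (φ.g-onV v)) (ψ.g-onV _)
    ; g-onE = λ e → trans (cong (onE (to ψ.g)) (φ.g-onE e)) (ψ.g-onE _) }
    where
    module φ = _≅ᴿ_ φ
    module ψ = _≅ᴿ_ ψ

  -- Normalisation leaves both sides and the nodes of the interface unchanged, so the same maps
  -- serve and the conditions on edges become vacuous.
  ≅ᴿ⇒≃ᴿ : {r₁ r₂ : Rule ℒ} → r₁ ≅ᴿ r₂ → r₁ ≃ᴿ r₂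
  ≅ᴿ⇒≃ᴿ {r₁} {r₂} φ = record
    { f = f ; g = g ; onK = discrete-≅ (Rule.K r₁) (Rule.K r₂) (V↔ onK)
    ; f-onV = f-onV ; f-onE = λ () ; g-onV = g-onV ; g-onE = λ () }
    where open _≅ᴿ_ φ

  -- This is idempotence of normalisation, as the relation compares `r ↓` with `r ↓ ↓`.
  ≃ᴿ-↓ : (r : Rule ℒ) → r ≃ᴿ r ↓
  ≃ᴿ-↓ r = record
    { f = ≅-refl ; g = ≅-refl ; onK = discrete-≅ (Rule.K r) (discrete (Rule.K r)) (↔-id _)
    ; f-onV = λ _ → refl ; f-onE = λ () ; g-onV = λ _ → refl ; g-onE = λ () }

-- Gluings

module Gluings {ℒ : Alphabet} (r : Rule ℒ) (G : TLRG ℒ)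
               (match : InjectiveMorphism (graph (Rule.L r)) (graph G)) where

  open Rule r
  open Match r G match
  private
    module L = TLRG L
    module K = Graph K
    module R = TLRG R
    module G = TLRG G
    module i = InjectiveMorphism K⊆L
    module j = InjectiveMorphism K⊆R
    module g = InjectiveMorphism match

  GlueV GlueE : Set
  GlueV = Unmatched g.onV ⊎ R.V
  GlueE = Unmatched g.onE ⊎ R.E

  -- EndOf endG endR e v: the source (or target) of e is v, where endG and
  -- endR are the source (or target) maps of G and R.
  data EndOf (endG : G.E → G.V) (endR : R.E → R.V) : GlueE → GlueV → Set where
    outside  : ∀ {e v} → value v ≡ endG (value e) →
               EndOf endG endR (inj₁ e) (inj₁ v)
    boundary : ∀ {e u} k → g.onV (i.onV k) ≡ endG (value e) → u ≡ j.onV k →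
               EndOf endG endR (inj₁ e) (inj₂ u)
    inside   : ∀ {d u} → u ≡ endR d → EndOf endG endR (inj₂ d) (inj₂ u)

  -- Specifies the result by bijections instead of constructing it, so that different graphs can
  -- satisfy the same specification. The relation `EndOf` serves for sources and targets because its
  -- totality requires the dangling condition.
  record Gluing (X : Graph ℒ) : Set where
    private module X = Graph X
    field
      nodes : GlueV ↔ X.V
      edges : GlueE ↔ X.E
    module nodes = Inverse nodes
    module edges = Inverse edges
    field
      s-glued : ∀ {e v} → EndOf G.s R.s e v → X.s (edges.to e) ≡ nodes.to v
      t-glued : ∀ {e v} → EndOf G.t R.t e v → X.t (edges.to e) ≡ nodes.to v
      l-glued : ∀ v → X.l (nodes.to v) ≡ [ G.l ∘ value , R.l ]′ v
      m-glued : ∀ e → X.m (edges.to e) ≡ [ G.m ∘ value , R.m ]′ e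
      p-glued : ∀ v → X.p (nodes.to v) ≡ [ G.p ∘ value , R.p ]′ v

  private
    i-V? : Decidable (_∈Im i.onV)
    i-V? u = finite-any? K.V-fin λ k → finite-≟ L.V-fin (i.onV k) u

    g-V? : Decidable (_∈Im g.onV)
    g-V? v = finite-any? L.V-fin λ u → finite-≟ G.V-fin (g.onV u) v

  -- Totality of `EndOf`: an outside edge ends outside the match or at the image of a node of `K`,
  -- since a matched node outside `K` is deleted and the dangling condition excludes it.
  end : ∀ {endG endR} → (∀ e → ¬ (e ∈Im g.onE) → ¬ DeletedV (endG e)) →
        ∀ e → ∃ (EndOf endG endR e)
  end {endG} undeleted (inj₂ d) = inj₂ _ , inside refl
  end {endG} undeleted (inj₁ (e , [ e∉g ])) with g-V? (endG e)
  ... | no  ∉g          = inj₁ (endG e , [ ∉g ]) , outside refl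
  ... | yes (u , gu≡end) with i-V? u
  ...   | yes (k , refl) = inj₂ (j.onV k) , boundary k gu≡end refl
  ...   | no  u∉i        = ⊥-elim-irr (undeleted e e∉g (u , gu≡end , u∉i))

  module _ (dang : Dangling) where

    private
      module _ {X Y : Graph ℒ} (γ : Gluing X) (δ : Gluing Y) where
        private
          module X = Graph X
          module Y = Graph Y
          module γ = Gluing γ
          module δ = Gluing δ

        -- `EndOf` does not mention `X` or `Y`, so one node of the glued set gives the end of the
        -- edge in both graphs.
        pres-end : {endG : G.E → G.V} {endR : R.E → R.V}
          {endX : X.E → X.V} {endY : Y.E → Y.V} →
          (∀ e → ¬ (e ∈Im g.onE) → ¬ DeletedV (endG e)) →
          (∀ {e v} → EndOf endG endR e v → endX (γ.edges.to e) ≡ γ.nodes.to v) →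
          (∀ {e v} → EndOf endG endR e v → endY (δ.edges.to e) ≡ δ.nodes.to v) →
          ∀ e → endY (δ.edges.to (γ.edges.from e)) ≡ δ.nodes.to (γ.nodes.from (endX e))
        pres-end {endX = endX} {endY} undeleted gluedX gluedY e
          with v , end-e ← end undeleted (γ.edges.from e) = begin
          endY (δ.edges.to (γ.edges.from e))
            ≡⟨ gluedY end-e ⟩
          δ.nodes.to v
            ≡⟨ cong δ.nodes.to (γ.nodes.strictlyInverseʳ v) ⟨
          δ.nodes.to (γ.nodes.from (γ.nodes.to v))
            ≡⟨ cong (δ.nodes.to ∘ γ.nodes.from) (gluedX end-e) ⟨
          δ.nodes.to (γ.nodes.from (endX (γ.edges.to (γ.edges.from e))))
            ≡⟨ cong (δ.nodes.to ∘ γ.nodes.from ∘ endX) (γ.edges.strictlyInverseˡ e) ⟩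
          δ.nodes.to (γ.nodes.from (endX e)) ∎
          where open ≡-Reasoning

        gluing-morphism : Morphism X Y
        gluing-morphism = record
          { onV = through γ.nodes δ.nodes
          ; onE = through γ.edges δ.edges
          ; pres-s = pres-end {endY = Y.s} (λ e ∉g → proj₁ (dang e ∉g)) γ.s-glued δ.s-glued
          ; pres-t = pres-end {endY = Y.t} (λ e ∉g → proj₂ (dang e ∉g)) γ.t-glued δ.t-glued
          ; pres-m = through-respects {y = Y.m} γ.edges δ.edges γ.m-glued δ.m-glued
          ; pres-l = λ v → trans (through-respects {y = Y.l} γ.nodes δ.nodes γ.l-glued δ.l-glued v)
          ; pres-p = λ v → trans (through-respects {y = Y.p} γ.nodes δ.nodes γ.p-glued δ.p-glued v)
          }

    gluing-unique : {X Y : Graph ℒ} → Gluing X → Gluing Y → X ≅ Y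
    gluing-unique γ δ = record
      { to = gluing-morphism γ δ ; from = gluing-morphism δ γ
      ; toV∘fromV = through-inverse δ.nodes γ.nodes
      ; fromV∘toV = through-inverse γ.nodes δ.nodes
      ; toE∘fromE = through-inverse δ.edges γ.edges
      ; fromE∘toE = through-inverse γ.edges δ.edges }
      where
      module γ = Gluing γ
      module δ = Gluing δ

    private
      -- The decision procedures repeat those that Match keeps private, so that
      -- abstracting over them also reduces embed and the result graph.
      module ReplaceV = Replacement i.onV-injective j.onV-injective g.onV-injective i-V?
        (λ u → finite-any? K.V-fin λ k → finite-≟ R.V-fin (j.onV k) u) g-V?

      module ReplaceE = Replacement i.onE-injective j.onE-injective g.onE-injective
        (λ d → finite-any? K.E-fin λ k → finite-≟ L.E-fin (i.onE k) d)
        (λ d → finite-any? K.E-fin λ k → finite-≟ R.E-fin (j.onE k) d)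
        (λ e → finite-any? L.E-fin λ d → finite-≟ G.E-fin (g.onE d) e)

      X : Graph ℒ
      X = graph (result dang)

      module X = Graph X

      embed≗place : ∀ u → embed dang u ≡ ReplaceV.place u
      embed≗place u with finite-any? K.V-fin (λ k → finite-≟ R.V-fin (j.onV k) u)
      ... | yes _ = refl
      ... | no  _ = refl

      -- The delicate case is an edge of `R` coming from `K`: the result takes its end from `G`, and
      -- this agrees with the end in `R` because the maps from `K` to `G` and to `R` commute with
      -- ends.
      end-glued : {endL : L.E → L.V} {endK : K.E → K.V} {endR : R.E → R.V} {endG : G.E → G.V}
        (survives : ∀ {e} → ¬ DeletedE e → ¬ DeletedV (endG e)) →
        (∀ k → endL (i.onE k) ≡ i.onV (endK k)) →
        (∀ k → endR (j.onE k) ≡ j.onV (endK k)) →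
        (∀ d → endG (g.onE d) ≡ g.onV (endL d)) →
        ∀ {e v} → EndOf endG endR e v →
        [ inj₁ ∘ Refinement.map endG survives , embed dang ∘ endR ∘ value ]′
          (Inverse.to ReplaceE.replaced e)
        ≡ Inverse.to ReplaceV.replaced v
      end-glued _ _ _ _ (outside refl) = refl
      end-glued _ _ _ _ (boundary k gik≡end refl) =
        trans (cong inj₁ (value-injective (sym gik≡end))) (sym (ReplaceV.place-preserved k))
      end-glued {endK = endK} {endR = endR} _ end-i end-j end-g (inside {d} refl)
        with finite-any? K.E-fin (λ k → finite-≟ R.E-fin (j.onE k) d)
      ... | no  _          = embed≗place (endR d)
      ... | yes (k , refl) = sym (begin
        ReplaceV.place (endR (j.onE k))
          ≡⟨ cong ReplaceV.place (end-j k) ⟩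
        ReplaceV.place (j.onV (endK k))
          ≡⟨ ReplaceV.place-preserved (endK k) ⟩
        inj₁ (g.onV (i.onV (endK k)) , [ K-survives (endK k) ])
          ≡⟨ cong inj₁ (value-injective
               (sym (trans (end-g (i.onE k)) (cong g.onV (end-i k))))) ⟩
        _ ∎)
        where open ≡-Reasoning

      module Attribute {A : Set} {xL : L.V → Maybe A} {xK : K.V → Maybe A}
        {xR : R.V → Maybe A} {xG : G.V → Maybe A}
        (pres-i : ∀ k {a} → xK k ≡ just a → xL (i.onV k) ≡ just a)
        (pres-j : ∀ k {a} → xK k ≡ just a → xR (j.onV k) ≡ just a)
        (pres-g : ∀ u {a} → xL u ≡ just a → xG (g.onV u) ≡ just a) where

        open Relabelling xK

        relabelled : G.V → Maybe A
        relabelled = redefine xR (undefine xG)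

        relabelled-kept : ∀ v → ¬ Undefined v → relabelled v ≡ xG v
        relabelled-kept v ¬undef with undefined? v in eq
        ... | yes undef = contradiction undef ¬undef
        -- `undefine` repeats the decision and appears only once `redefine` has reduced.
        ... | no  _ rewrite eq = refl

        -- Where `K` defines the attribute, the value in `G` is kept, and it equals the one in `R`
        -- since both extend that of `K`. Where `K` leaves it undefined, the value is set from `R`.
        relabelled-preserved : ∀ k → relabelled (g.onV (i.onV k)) ≡ xR (j.onV k)
        relabelled-preserved k with xK k in xKk
        ... | just a = trans (relabelled-kept _ λ (k′ , gik′≡gik , xKk′) →
                                contradiction
                                  (trans (sym xKk′)
                                    (trans (cong xK (i.onV-injective (g.onV-injective gik′≡gik)))
                                           xKk))
                                  λ ())
                             (trans (pres-g _ (pres-i k xKk)) (sym (pres-j k xKk)))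
        ... | nothing with undefined? (g.onV (i.onV k))
        ...   | yes (_ , gik′≡gik , _) =
          cong (xR ∘ j.onV) (i.onV-injective (g.onV-injective gik′≡gik))
        ...   | no  ¬undef = contradiction (k , refl , xKk) ¬undef

        attribute-glued : ∀ v →
          [ relabelled ∘ value , xR ∘ value ]′ (Inverse.to ReplaceV.replaced v)
          ≡ [ xG ∘ value , xR ]′ v
        attribute-glued (inj₁ (v , [ v∉g ])) =
          relabelled-kept v λ (k , gik≡v , _) → ⊥-elim-irr (v∉g (i.onV k , gik≡v))
        attribute-glued (inj₂ u) with finite-any? K.V-fin (λ k → finite-≟ R.V-fin (j.onV k) u)
        ... | no  _          = refl
        ... | yes (k , refl) = relabelled-preserved k

      result-m : ∀ e → X.m (Inverse.to ReplaceE.replaced e) ≡ [ G.m ∘ value , R.m ]′ e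
      result-m (inj₁ e) = refl
      result-m (inj₂ d) with finite-any? K.E-fin (λ k → finite-≟ R.E-fin (j.onE k) d)
      ... | no  _          = refl
      ... | yes (k , refl) =
        trans (g.pres-m (i.onE k)) (trans (i.pres-m k) (sym (j.pres-m k)))

    result-gluing : Gluing X
    result-gluing = record
      { nodes = ReplaceV.replaced
      ; edges = ReplaceE.replaced
      ; s-glued = end-glued (s-survives dang) i.pres-s j.pres-s g.pres-s
      ; t-glued = end-glued (t-survives dang) i.pres-t j.pres-t g.pres-t
      ; l-glued = Attribute.attribute-glued i.pres-l j.pres-l g.pres-l
      ; m-glued = result-m
      ; p-glued = Attribute.attribute-glued i.pres-p j.pres-p g.pres-p }

open Gluings using (Gluing; gluing-unique; result-gluing; outside; boundary; inside)

-- Normalisation equivalence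

module Transport {ℒ : Alphabet} (r₁ r₂ : Rule ℒ) (φ : r₂ ≃ᴿ r₁) (G : TLRG ℒ)
                 (match : InjectiveMorphism (graph (Rule.L r₁)) (graph G)) where

  private
    module r₁ = Rule r₁
    module r₂ = Rule r₂
    module φ = _≅ᴿ_ φ
    module K₁ = InjectiveMorphism r₁.K⊆L
    module K₂ = InjectiveMorphism r₂.K⊆L
    module f = InjectiveMorphism (≅⇒injective φ.f)
    module g = Morphism (_≅_.to φ.g)
    module M = InjectiveMorphism match
    open Morphism using (onV; onE)
    open Gluings using (EndOf; GlueV; GlueE)

  -- Precomposition is possible because `φ` points from `r₂` to `r₁`.
  match′ : InjectiveMorphism (graph r₂.L) (graph G)
  match′ = match ∘ᴵ ≅⇒injective φ.f

  private
    -- Precomposing with a bijection does not change the image, so the identity on values works both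
    -- ways.
    unmatched↔ : {A B C : Set} (a : A ↔ B) (h : B → C) →
                 Unmatched (h ∘ Inverse.to a) ↔ Unmatched h
    unmatched↔ a h = mk↔ₛ′
      (Refinement.map id λ ∉ha (b , hb≡c) →
        ∉ha (a.from b , trans (cong h (a.strictlyInverseˡ b)) hb≡c))
      (Refinement.map id λ ∉h (x , hax≡c) → ∉h (a.to x , hax≡c))
      (λ _ → refl) (λ _ → refl)
      where module a = Inverse a

    glueV↔ : GlueV r₂ G match′ ↔ GlueV r₁ G match
    glueV↔ = unmatched↔ (V↔ φ.f) M.onV ⊎-↔ V↔ φ.g

    glueE↔ : GlueE r₂ G match′ ↔ GlueE r₁ G match
    glueE↔ = unmatched↔ (E↔ φ.f) M.onE ⊎-↔ E↔ φ.g

    -- Interfaces enter `EndOf` only through their nodes, so an isomorphism of the discrete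
    -- interfaces suffices.
    end-map : ∀ {endG endR₁ endR₂} →
      (∀ d → endR₁ (g.onE d) ≡ g.onV (endR₂ d)) → ∀ {e v} →
      EndOf r₂ G match′ endG endR₂ e v →
      EndOf r₁ G match endG endR₁ (Inverse.to glueE↔ e) (Inverse.to glueV↔ v)
    end-map pres (outside eq)        = outside eq
    end-map pres (boundary k eq refl) =
      boundary (onV (_≅_.to φ.onK) k)
        (trans (cong M.onV (sym (φ.f-onV k))) eq) (φ.g-onV k)
    end-map pres (inside refl)       = inside (sym (pres _))

  -- Both matches have the same image, and a node deleted by `r₂` is deleted by `r₁` since `φ`
  -- matches up the interface nodes.
  dangling′ : Match.Dangling r₁ G match → Match.Dangling r₂ G match′
  dangling′ dang e e∉ =
    let s∉ , t∉ = dang e e∉match in s∉ ∘ deleted , t∉ ∘ deleted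
    where
    e∉match : ¬ (e ∈Im M.onE)
    e∉match (d , eq) =
      e∉ (Inverse.from (E↔ φ.f) d , trans (cong M.onE (_≅_.toE∘fromE φ.f d)) eq)
    deleted : ∀ {v} → Match.DeletedV r₂ G match′ v → Match.DeletedV r₁ G match v
    deleted (u , eq , u∉K₂) = f.onV u , eq , λ (k , K₁k≡fu) →
      u∉K₂ (onV (_≅_.from φ.onK) k , f.onV-injective (begin
        f.onV (K₂.onV (onV (_≅_.from φ.onK) k))
          ≡⟨ φ.f-onV _ ⟩
        K₁.onV (onV (_≅_.to φ.onK) (onV (_≅_.from φ.onK) k))
          ≡⟨ cong K₁.onV (_≅_.toV∘fromV φ.onK k) ⟩
        K₁.onV k
          ≡⟨ K₁k≡fu ⟩
        f.onV u ∎))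
      where open ≡-Reasoning

  gluing′ : ∀ {X} → Gluing r₁ G match X → Gluing r₂ G match′ X
  gluing′ γ = record
    { nodes = nodes ↔-∘ glueV↔
    ; edges = edges ↔-∘ glueE↔
    ; s-glued = s-glued ∘ end-map g.pres-s
    ; t-glued = t-glued ∘ end-map g.pres-t
    ; l-glued = λ where
        (inj₁ v) → l-glued _
        (inj₂ u) → trans (l-glued _) (preserves-l r₂.R (_≅_.to φ.g) u)
    ; m-glued = λ where
        (inj₁ e) → m-glued _
        (inj₂ d) → trans (m-glued _) (g.pres-m d)
    ; p-glued = λ where
        (inj₁ v) → p-glued _
        (inj₂ u) → trans (p-glued _) (preserves-p r₂.R (_≅_.to φ.g) u)
    }
    where open Gluing γ

module _ {ℒ : Alphabet} where

  -- The result of `r₁` is also a gluing for `r₂`, hence isomorphic to the result of `r₂` by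
  -- uniqueness of gluings.
  ⇒-resp-≃ᴿ : (G H : TLRG ℒ) (r₁ r₂ : Rule ℒ) → r₁ ≃ᴿ r₂ → G ⇒⟨ r₁ ⟩ H → G ⇒⟨ r₂ ⟩ H
  ⇒-resp-≃ᴿ G H r₁ r₂ r₁≃r₂ (match , dang , H≅result) =
    match′ , dang′ ,
    ≅-trans H≅result
      (gluing-unique r₂ G match′ dang′
        (gluing′ (result-gluing r₁ G match dang))
        (result-gluing r₂ G match′ dang′))
    where
    open Transport r₁ r₂ (≅ᴿ-sym r₁≃r₂) G match
    dang′ = dangling′ dang

  -- The three implications.

  SameClasses-sym : {_∼_ : Rule ℒ → Rule ℒ → Set} {R₁ R₂ : List (Rule ℒ)} →
                    SameClasses _∼_ R₁ R₂ → SameClasses _∼_ R₂ R₁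
  SameClasses-sym same r = ⇔-sym (same r)

  -- By reflexivity, a rule of `R₁` with property `P` represents its own class; `R₂` then represents
  -- that class too, and `P` passes to the representative.
  SameClasses-transfer : (_∼_ : Rule ℒ → Rule ℒ → Set) → (∀ r → r ∼ r) →
    (P : Rule ℒ → Set) → (∀ r₁ r₂ → r₁ ∼ r₂ → P r₁ → P r₂) →
    {R₁ R₂ : List (Rule ℒ)} → SameClasses _∼_ R₁ R₂ → Any P R₁ → Any P R₂
  SameClasses-transfer _ ∼-refl _ resp same any with r , r∈R₁ , Pr ← find any =
    Any.map (λ {r₂} r∼r₂ → resp r r₂ r∼r₂ Pr)
      (Equivalence.to (same r) (Any.map (λ { refl → ∼-refl r }) r∈R₁))

  ≅ᵀ⇒≃N : (T₁ T₂ : GTSystem ℒ) → T₁ ≅ᵀ T₂ → T₁ ≃N T₂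
  ≅ᵀ⇒≃N _ _ T₁≅T₂ r = mk⇔ (transfer T₁≅T₂) (transfer (SameClasses-sym T₁≅T₂))
    where
    transfer : {R₁ R₂ : List (Rule ℒ)} →
               SameClasses _≅ᴿ_ R₁ R₂ → Any (r ≃ᴿ_) R₁ → Any (r ≃ᴿ_) R₂
    transfer = SameClasses-transfer _≅ᴿ_ (λ _ → ≅ᴿ-refl) (r ≃ᴿ_)
      λ r₁ r₂ r₁≅r₂ r≃r₁ → ≅ᴿ-trans r≃r₁ (≅ᴿ⇒≃ᴿ r₁≅r₂)

  ≃N⇒≃S : (T₁ T₂ : GTSystem ℒ) → T₁ ≃N T₂ → T₁ ≃S T₂
  ≃N⇒≃S _ _ T₁≃T₂ G H = mk⇔ (transfer T₁≃T₂) (transfer (SameClasses-sym T₁≃T₂))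
    where
    transfer : {R₁ R₂ : List (Rule ℒ)} →
               SameClasses _≃ᴿ_ R₁ R₂ → Any (G ⇒⟨_⟩ H) R₁ → Any (G ⇒⟨_⟩ H) R₂
    transfer = SameClasses-transfer _≃ᴿ_ (λ _ → ≅ᴿ-refl) (G ⇒⟨_⟩ H) (⇒-resp-≃ᴿ G H)

  ≃S⇒≃F : (T₁ T₂ : GTSystem ℒ) → T₁ ≃S T₂ → T₁ ≃F T₂
  ≃S⇒≃F T₁ T₂ T₁≃T₂ G =
    (λ {x} → ⊆-semantics T₁ T₂ T₁≃T₂ x) ,
    (λ {x} → ⊆-semantics T₂ T₁ (λ G H → ⇔-sym (T₁≃T₂ G H)) x)
    where
    ⊆-semantics : (T T′ : GTSystem ℒ) → T ≃S T′ →
                  ∀ x → semantics T G x → semantics T′ G x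
    ⊆-semantics T T′ T≃T′ (just H) ((H′ , steps , H′≅H) , nf) =
      (H′ , Star.map (λ {I} {J} → Equivalence.to (T≃T′ I J)) steps , H′≅H) ,
      -- Irreducibility is contravariant: a step of `T′` from `H` is pulled back to `T`.
      λ (I , step) → nf (I , Equivalence.from (T≃T′ H I) step)
    ⊆-semantics T T′ T≃T′ nothing (γ , G≅γ₀ , steps) =
      γ , G≅γ₀ , λ n → Equivalence.to (T≃T′ (γ n) (γ (suc n))) (steps n)

-- Counterexamples to the converses

module _ {ℒ : Alphabet} where

  idRule : TLRG ℒ → Rule ℒ
  idRule P = record
    { L = P ; K = graph P ; R = P
    ; K⊆L = ≅⇒injective ≅-refl ; K⊆R = ≅⇒injective ≅-refl }

  module _ (P G : TLRG ℒ) (match : InjectiveMorphism (graph P) (graph G)) where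
    private
      module P = TLRG P
      module G = TLRG G
      module g = InjectiveMorphism match

      rejoin : {A B : Set} → Finite A → Finite B → (h : A → B) → Injective _≡_ _≡_ h →
               (Unmatched h ⊎ A) ↔ B
      rejoin {A} {B} A-fin B-fin h h-injective =
        mk↔ₛ′ [ value , h ]′ split to∘split split∘to
        where
        h? : Decidable (_∈Im h)
        h? b = finite-any? A-fin λ a → finite-≟ B-fin (h a) b
        split : B → Unmatched h ⊎ A
        split b with h? b
        ... | yes (a , _) = inj₂ a
        ... | no  b∉h     = inj₁ (b , [ b∉h ])
        to∘split : ∀ b → [ value , h ]′ (split b) ≡ b
        to∘split b with h? b
        ... | yes (_ , ha≡b) = ha≡b
        ... | no  _          = refl
        split∘to : ∀ x → split ([ value , h ]′ x) ≡ x
        split∘to (inj₁ (b , [ b∉h ])) with h? b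
        ... | yes b∈h = ⊥-elim-irr (b∉h b∈h)
        ... | no  _   = refl
        split∘to (inj₂ a) with h? (h a)
        ... | yes (_ , ha′≡ha) = cong inj₂ (h-injective ha′≡ha)
        ... | no  ha∉h         = contradiction (a , refl) ha∉h

      end-glued : ∀ {endG : G.E → G.V} {endP : P.E → P.V} →
        (∀ d → endG (g.onE d) ≡ g.onV (endP d)) →
        ∀ {e v} → Gluings.EndOf (idRule P) G match endG endP e v →
        endG ([ value , g.onE ]′ e) ≡ [ value , g.onV ]′ v
      end-glued pres (outside eq)         = sym eq
      end-glued pres (boundary k eq refl) = sym eq
      end-glued pres (inside refl)        = pres _

    -- Putting `P` back in place of its image restores `G`, so `G` itself meets the specification of
    -- the result.
    idRule-gluing : Gluing (idRule P) G match (graph G)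
    idRule-gluing = record
      { nodes = rejoin P.V-fin G.V-fin g.onV g.onV-injective
      ; edges = rejoin P.E-fin G.E-fin g.onE g.onE-injective
      ; s-glued = end-glued g.pres-s
      ; t-glued = end-glued g.pres-t
      ; l-glued = λ where
          (inj₁ v) → refl
          (inj₂ u) → preserves-l P g.morphism u
      ; m-glued = λ where
          (inj₁ e) → refl
          (inj₂ d) → g.pres-m d
      ; p-glued = λ where
          (inj₁ v) → refl
          (inj₂ u) → preserves-p P g.morphism u
      }

    idRule-result : (dang : Match.Dangling (idRule P) G match) →
                    graph G ≅ graph (Match.result (idRule P) G match dang)
    idRule-result dang = gluing-unique (idRule P) G match dang
      idRule-gluing (result-gluing (idRule P) G match dang)

  idRule-step⇒≅ : (P G H : TLRG ℒ) → G ⇒⟨ idRule P ⟩ H → graph H ≅ graph G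
  idRule-step⇒≅ P G H (match , dang , H≅result) =
    ≅-trans H≅result (≅-sym (idRule-result P G match dang))

  ∅ : TLRG ℒ
  ∅ = record
    { graph = record
      { V = ⊥ ; E = ⊥ ; V-fin = finite-⊥ ; E-fin = finite-⊥
      ; s = λ () ; t = λ () ; l = λ () ; m = λ () ; p = λ () }
    ; l-total = λ () ; p-total = λ () }

  ∅⊆ : (G : Graph ℒ) → InjectiveMorphism (graph ∅) G
  ∅⊆ G = record
    { morphism = record
      { onV = λ () ; onE = λ () ; pres-s = λ () ; pres-t = λ () ; pres-m = λ ()
      ; pres-l = λ () ; pres-p = λ () }
    ; onV-injective = λ { {()} }
    ; onE-injective = λ { {()} } }

  -- The empty match exists in every graph and deletes nothing, so it satisfies the dangling
  -- condition and leaves `G` as the result up to isomorphism.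
  ≅⇒idRule∅-step : (G H : TLRG ℒ) → graph H ≅ graph G → G ⇒⟨ idRule ∅ ⟩ H
  ≅⇒idRule∅-step G H H≅G =
    ∅⊆ (graph G) , dang , ≅-trans H≅G (idRule-result ∅ G (∅⊆ (graph G)) dang)
    where
    dang : Match.Dangling (idRule ∅) G (∅⊆ (graph G))
    dang _ _ = (λ ()) , (λ ())

  -- A loop at every graph rules out normal forms and makes the constant sequence infinite, so both
  -- semantic functions always yield just the divergence element.
  semantics-reflexive : (T₁ T₂ : GTSystem ℒ) →
    (∀ G → T₁ ⊢ G ⟶ G) → (∀ G → T₂ ⊢ G ⟶ G) → T₁ ≃F T₂
  semantics-reflexive T₁ T₂ loop₁ loop₂ G =
    (λ {x} → ⊆-semantics T₁ T₂ loop₁ loop₂ x) ,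
    (λ {x} → ⊆-semantics T₂ T₁ loop₂ loop₁ x)
    where
    ⊆-semantics : (T T′ : GTSystem ℒ) →
      (∀ G → T ⊢ G ⟶ G) → (∀ G → T′ ⊢ G ⟶ G) →
      ∀ x → semantics T G x → semantics T′ G x
    ⊆-semantics T T′ loop loop′ (just H) (_ , nf) = contradiction (H , loop H) nf
    ⊆-semantics T T′ loop loop′ nothing  _        = (λ _ → G) , ≅-refl , λ _ → loop′ G

-- The three separating pairs of systems.

unlabelled : Alphabet
unlabelled = record
  { LV = Fin 1 ; LE = Fin 1
  ; LV-fin = 1 , ↔-id _ ; LE-fin = 1 , ↔-id _ }

• : TLRG unlabelled
• = record
  { graph = record
    { V = Fin 1 ; E = ⊥ ; V-fin = 1 , ↔-id _ ; E-fin = finite-⊥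
    ; s = λ () ; t = λ () ; l = λ _ → just zero ; m = λ () ; p = λ _ → just zero }
  ; l-total = λ _ → Maybe.just tt
  ; p-total = λ _ → Maybe.just tt }

create• : Rule unlabelled
create• = record
  { L = ∅ ; K = graph ∅ ; R = • ; K⊆L = ∅⊆ (graph ∅) ; K⊆R = ∅⊆ (graph •) }

system : List (Rule unlabelled) → GTSystem unlabelled
system rs = record { rules = rs }

id•≃Nid•↓ : system (idRule • ∷ []) ≃N system (idRule • ↓ ∷ [])
id•≃Nid•↓ r = mk⇔
  (λ { (here r≃) → here (≅ᴿ-trans r≃ (≃ᴿ-↓ (idRule •))) })
  (λ { (here r≃) → here (≅ᴿ-trans r≃ (≅ᴿ-sym (≃ᴿ-↓ (idRule •)))) })

id•≇id•↓ : ¬ (system (idRule • ∷ []) ≅ᵀ system (idRule • ↓ ∷ []))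
id•≇id•↓ same with Equivalence.to (same (idRule •)) (here ≅ᴿ-refl)
-- The node of the first interface is labelled, whereas its image in the normalised interface has no
-- label.
... | here φ with () ← Morphism.pres-l (_≅_.to (_≅ᴿ_.onK φ)) zero refl

id∅≃Sid∅,id• : system (idRule ∅ ∷ []) ≃S system (idRule ∅ ∷ idRule • ∷ [])
id∅≃Sid∅,id• G H = mk⇔
  (λ { (here step) → here step })
  (λ { (here step)         → here step
     ; (there (here step)) → here (≅⇒idRule∅-step G H (idRule-step⇒≅ • G H step)) })

id∅≄Nid∅,id• : ¬ (system (idRule ∅ ∷ []) ≃N system (idRule ∅ ∷ idRule • ∷ []))
id∅≄Nid∅,id• same with Equivalence.from (same (idRule •)) (there (here ≅ᴿ-refl))
-- The left-hand sides would be isomorphic, sending the node of `•` into the empty graph.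
... | here φ with () ← Morphism.onV (_≅_.to (_≅ᴿ_.f φ)) zero

id∅≃Fid∅,create• : system (idRule ∅ ∷ []) ≃F system (idRule ∅ ∷ create• ∷ [])
id∅≃Fid∅,create• =
  semantics-reflexive (system (idRule ∅ ∷ [])) (system (idRule ∅ ∷ create• ∷ []))
    (λ G → here (loop G)) (λ G → here (loop G))
  where
  loop : ∀ G → G ⇒⟨ idRule ∅ ⟩ G
  loop G = ≅⇒idRule∅-step G G ≅-refl

id∅≄Sid∅,create• : ¬ (system (idRule ∅ ∷ []) ≃S system (idRule ∅ ∷ create• ∷ []))
id∅≄Sid∅,create• same =
  impossible (Equivalence.from (same ∅ created) (there (here create-step)))
  where
  dang : Match.Dangling create• ∅ (∅⊆ (graph ∅))
  dang ()
  created : TLRG unlabelled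
  created = Match.result create• ∅ (∅⊆ (graph ∅)) dang
  create-step : ∅ ⇒⟨ create• ⟩ created
  create-step = ∅⊆ (graph ∅) , dang , ≅-refl
  impossible : ¬ (system (idRule ∅ ∷ []) ⊢ ∅ ⟶ created)
  impossible (here step) =
    -- The step would make `created` isomorphic to `∅`, but `created` contains the new node.
    Morphism.onV (_≅_.to (idRule-step⇒≅ ∅ ∅ created step)) (inj₂ (zero , [ (λ ()) ]))

theorem3p4 : ((ℒ : Alphabet) (T₁ T₂ : GTSystem ℒ) →
    (T₁ ≅ᵀ T₂ → T₁ ≃N T₂) × (T₁ ≃N T₂ → T₁ ≃S T₂) × (T₁ ≃S T₂ → T₁ ≃F T₂))
    × (Σ[ ℒ ∈ Alphabet ] Σ[ T₁ ∈ GTSystem ℒ ] Σ[ T₂ ∈ GTSystem ℒ ]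
    (T₁ ≃N T₂ × ¬ (T₁ ≅ᵀ T₂)))
    × (Σ[ ℒ ∈ Alphabet ] Σ[ T₁ ∈ GTSystem ℒ ] Σ[ T₂ ∈ GTSystem ℒ ]
    (T₁ ≃S T₂ × ¬ (T₁ ≃N T₂)))
    × (Σ[ ℒ ∈ Alphabet ] Σ[ T₁ ∈ GTSystem ℒ ] Σ[ T₂ ∈ GTSystem ℒ ]
    (T₁ ≃F T₂ × ¬ (T₁ ≃S T₂)))
theorem3p4 =
  (λ _ T₁ T₂ → ≅ᵀ⇒≃N T₁ T₂ , ≃N⇒≃S T₁ T₂ , ≃S⇒≃F T₁ T₂) ,
  (_ , _ , _ , id•≃Nid•↓ , id•≇id•↓) ,
  (_ , _ , _ , id∅≃Sid∅,id• , id∅≄Nid∅,id•) ,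
  (_ , _ , _ , id∅≃Fid∅,create• , id∅≄Sid∅,create•)
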